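{- The following inequalities between cardinals are provable in $\mathsf{ZFC}$. (1) (Null ideal) $\mathfrak b(\in^*_{\mathcal N})\le \mathfrak b(\leq^*_{\mathcal N})\le \mathfrak b(\neq^*_{\mathcal N})\le \mathfrak d(\in^*_{\mathcal N})$; $\ \mathfrak b(\in^*_{\mathcal N})\le \mathfrak d(\neq^*_{\mathcal N})\le \mathfrak d(\leq^*_{\mathcal N})\le \mathfrak d(\in^*_{\mathcal N})$; and $\mathfrak b(\leq^*_{\mathcal N})\le \mathfrak d(\leq^*_{\mathcal N})$. (2) (Meager ideal) $\mathfrak b(\in^*_{\mathcal M})\le \mathfrak b(\leq^*_{\mathcal M})\le \mathfrak b(\neq^*_{\mathcal M})\le \mathfrak d(\in^*_{\mathcal M})$; $\ \mathfrak b(\in^*_{\mathcal M})\le \mathfrak d(\neq^*_{\mathcal M})\le \mathfrak d(\leq^*_{\mathcal M})\le \mathfrak d(\in^*_{\mathcal M})$; and $\mathfrak b(\leq^*_{\mathcal M})\le \mathfrak d(\leq^*_{\mathcal M})$. (3) ($\sigma$-compact ideal) $\mathfrak b(\in^*_{\mathcal K})\le \mathfrak b(\leq^*_{\mathcal K})\le \mathfrak b(\neq^*_{\mathcal K})$ and $\mathfrak d(\neq^*_{\mathcal K})\le \mathfrak d(\leq^*_{\mathcal K})\le \mathfrak d(\in^*_{\mathcal K})$. (4) (Comparison) For each $R\in\{\in^*,\leq^*,\neq^*\}$: $\mathfrak b(R_{\mathcal K})\le \mathfrak b(R_{\mathcal M})$ and $\mathfrak d(R_{\mathcal M})\le \mathfrak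 d(R_{\mathcal K})$.
   Context: $\omega^\omega$ is Baire space with Lebesgue measure $\mu$: the (completed) Borel measure with $\mu(N_s)=\prod_{i<\mathrm{length}(s)}2^{ -(s(i)+1)}$ for $s\in\omega^{<\omega}$, where $N_s=\{x\in\omega^\omega: s\subseteq x\}$. $\mathcal N$ is the ideal of $\mu$-null subsets of $\omega^\omega$, $\mathcal M$ the ideal of meager subsets of $\omega^\omega$, and $\mathcal K$ the ideal of subsets of $\omega^\omega$ contained in a $\sigma$-compact set. A slalom is a function $s:\omega\to[\omega]^{<\omega}$ with $|s(n)|\le n$ for all $n$; $\mathcal S$ is the set of slaloms. For $x,y\in\omega^\omega$ and $s\in\mathcal S$: $x\leq^* y$ iff $x(n)\le y(n)$ for all but finitely many $n$; $x\neq^* y$ iff $x(n)\ne y(n)$ for all but finitely many $n$; $x\in^* s$ iff $x(n)\in s(n)$ for all but finitely many $n$. For $\mathcal I\in\{\mathcal N,\mathcal M,\mathcal K\}$, $R\in\{\leq^*,\neq^*,\in^*\}$, $f:\omega^\omega\to\omega^\omega$ and $g:\omega^\omega\to\omega^\omega$ ($g:\omega^\omega\to\mathcal S$ if $R$ is $\in^*$), write $f R_{\mathcal I} g$ iff $\{x\in\omega^\omega:\neg\, f(x) R g(x)\}\in\mathcal I$. Then $\mathfrak b(R_{\mathcal I})$ is the least size of a set $A$ of functions $\omega^\omega\to\omega^\omega$ for which there is no $g:\omega^\omega\to\omega^\omega$ (no $g:\omega^\omega\to\mathcal S$ if $R$ is $\in^*$) with $f R_{\mathcal I} g$ for all $f\in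 A$; and $\mathfrak d(R_{\mathcal I})$ is the least size of a set $A$ of functions $\omega^\omega\to\omega^\omega$ (functions $\omega^\omega\to\mathcal S$ if $R$ is $\in^*$) such that for every $g:\omega^\omega\to\omega^\omega$ there is $f\in A$ with $g R_{\mathcal I} f$. -}

module Defs where

open import Level using (Level; 0ℓ; _⊔_) renaming (suc to lsuc)
open import Data.Fin.Base using (toℕ)
open import Data.List.Base using (List; []; _∷_; length; lookup)
import Data.List.Membership.Propositional as List∈
open import Data.List.Relation.Unary.Any using (Any)
open import Data.List.Relation.Unary.Linked using (Linked)
open import Data.Nat.Base as ℕ using (ℕ; zero; suc)
open import Data.Product.Base using (Σ-syntax; ∃; ∃-syntax; _×_)
open import Data.Rational.Base as ℚ using (ℚ; 0ℚ; 1ℚ; ½)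
open import Function.Bundles using (_↣_; Injection; _⇔_)
open import Relation.Binary.PropositionalEquality.Core using (_≡_; _≢_)
open import Relation.Nullary.Negation.Core using (¬_)
open import Relation.Unary using (Pred; _∈_; _⊆_; _≐_; ⋃; Empty)

private
  variable
    ℓ ℓ′ : Level
    F : Set

-- A cardinal number is given by the types that represent it, i.e. those
-- of that size.
Cardinal : (ℓ : Level) → Set (lsuc 0ℓ ⊔ lsuc ℓ)
Cardinal ℓ = Pred Set ℓ

-- The order requires representatives on both sides, so an inequality
-- includes the claim that both cardinals exist.  The cardinals compared
-- below are closed under bijection and have only equinumerous
-- representatives, so the choice of representatives is immaterial.
infix 4 _≼_
_≼_ : Cardinal ℓ → Cardinal ℓ′ → Set _
𝔞 ≼ 𝔠 = ∃[ κ ] ∃[ θ ] κ ∈ 𝔞 × θ ∈ 𝔠 × (κ ↣ θ)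

-- κ enumerates the elements of A without repetition.  (The type ∃ A would
-- also count the different proofs of membership in A.)
HasSize : Pred F 0ℓ → Set → Set
HasSize {F} A κ =
  Σ[ e ∈ (κ ↣ F) ] (∀ f → (f ∈ A) ⇔ (∃[ k ] Injection.to e k ≡ f))

-- The least size of a set A ⊆ F with the property P.
LeastSize : Pred (Pred F 0ℓ) ℓ → Cardinal (lsuc 0ℓ ⊔ ℓ)
LeastSize P κ =
  (∃[ A ] P A × HasSize A κ) ×
  (∀ A θ → P A → HasSize A θ → κ ↣ θ)

Baire : Set
Baire = ℕ → ℕ

N : List ℕ → Pred Baire 0ℓ
N s x = ∀ i → x (toℕ i) ≡ lookup s i

IsOpen : Pred Baire 0ℓ → Set
IsOpen U = ∀ x → x ∈ U → ∃[ s ] x ∈ N s × N s ⊆ U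

Interior : Pred Baire 0ℓ → Pred Baire 0ℓ
Interior A x = ∃[ s ] x ∈ N s × N s ⊆ A

Closure : Pred Baire 0ℓ → Pred Baire 0ℓ
Closure A x = ∀ s → x ∈ N s → ∃[ y ] y ∈ N s × y ∈ A

IsCompact : Pred Baire 0ℓ → Set₁
IsCompact C =
  ∀ {I : Set} (U : I → Pred Baire 0ℓ) → (∀ i → IsOpen (U i)) → C ⊆ ⋃ I U →
  Σ[ is ∈ List I ] (∀ x → x ∈ C → Any (λ i → x ∈ U i) is)

½^ : ℕ → ℚ
½^ zero    = 1ℚ
½^ (suc n) = ½ ℚ.* ½^ n

μN : List ℕ → ℚ
μN []      = 1ℚ
μN (k ∷ s) = ½^ (suc k) ℚ.* μN s

∑< : ℕ → (ℕ → ℚ) → ℚ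
∑< zero    a = 0ℚ
∑< (suc m) a = ∑< m a ℚ.+ a m

-- OuterMeasure≤ A q says μ*(A) ≤ q, where μ* is the Carathéodory outer
-- measure
--   μ*(A) = inf { ∑ᵢ μ(N (c i)) : A ⊆ ⋃ᵢ N (c i) },
-- whose restriction to the measurable sets is the completed Borel measure
-- with the prescribed values μN s on the sets N s.  A series of
-- non-negative terms is bounded by r iff all its partial sums are.
OuterMeasure≤ : Pred Baire 0ℓ → ℚ → Set
OuterMeasure≤ A q =
  ∀ ε → 0ℚ ℚ.< ε →
  Σ[ c ∈ (ℕ → List ℕ) ]
    A ⊆ ⋃ ℕ (λ i → N (c i)) ×
    (∀ m → ∑< m (λ i → μN (c i)) ℚ.≤ q ℚ.+ ε)

Ideal : (ℓ : Level) → Set (lsuc 0ℓ ⊔ lsuc ℓ)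
Ideal ℓ = Pred (Pred Baire 0ℓ) ℓ

𝒩 : Ideal 0ℓ
𝒩 A = OuterMeasure≤ A 0ℚ

NowhereDense : Pred Baire 0ℓ → Set
NowhereDense D = Empty (Interior (Closure D))

ℳ : Ideal (lsuc 0ℓ)
ℳ A = Σ[ D ∈ (ℕ → Pred Baire 0ℓ) ] (∀ n → NowhereDense (D n)) × A ⊆ ⋃ ℕ D

IsσCompact : Pred Baire 0ℓ → Set₁
IsσCompact B =
  Σ[ C ∈ (ℕ → Pred Baire 0ℓ) ] (∀ n → IsCompact (C n)) × B ≐ ⋃ ℕ C

𝒦 : Ideal (lsuc 0ℓ)
𝒦 A = ∃[ B ] IsσCompact B × A ⊆ B

-- A finite set of naturals is listed in strictly increasing order; together
-- with the irrelevance of the proofs here and in Slalom, this makes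
-- propositional equality the equality of finite sets and of slaloms.
record FinSet : Set where
  constructor finSet
  field
    elements    : List ℕ
    .increasing : Linked ℕ._<_ elements

infix 4 _∈ᶠ_
_∈ᶠ_ : ℕ → FinSet → Set
k ∈ᶠ a = k List∈.∈ FinSet.elements a

∣_∣ᶠ : FinSet → ℕ
∣ a ∣ᶠ = length (FinSet.elements a)

record Slalom : Set where
  constructor slalom
  field
    at     : ℕ → FinSet
    .width : ∀ n → ∣ at n ∣ᶠ ℕ.≤ n

∀* : Pred ℕ 0ℓ → Set
∀* P = ∃[ m ] (∀ n → m ℕ.≤ n → P n)

data Rel : Set where
  ≤* ≠* ∈* : Rel

Bound : Rel → Set
Bound ≤* = Baire
Bound ≠* = Baire
Bound ∈* = Slalom

_⟨_⟩_ : Baire → (R : Rel) → Bound R → Set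
x ⟨ ≤* ⟩ y = ∀* λ n → x n ℕ.≤ y n
x ⟨ ≠* ⟩ y = ∀* λ n → x n ≢ y n
x ⟨ ∈* ⟩ s = ∀* λ n → x n ∈ᶠ Slalom.at s n

_⟨_/_⟩_ : (Baire → Baire) → (R : Rel) → Ideal ℓ → (Baire → Bound R) → Set ℓ
f ⟨ R / 𝓘 ⟩ g = (λ x → ¬ (f x ⟨ R ⟩ g x)) ∈ 𝓘

Unbounded : (R : Rel) → Ideal ℓ → Pred (Pred (Baire → Baire) 0ℓ) ℓ
Unbounded R 𝓘 A =
  ¬ (Σ[ g ∈ (Baire → Bound R) ] (∀ f → f ∈ A → f ⟨ R / 𝓘 ⟩ g))

Dominating : (R : Rel) → Ideal ℓ → Pred (Pred (Baire → Bound R) 0ℓ) ℓ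
Dominating R 𝓘 A =
  ∀ (g : Baire → Baire) → ∃[ f ] f ∈ A × g ⟨ R / 𝓘 ⟩ f

𝔟 𝔡 : Rel → Ideal ℓ → Cardinal (lsuc 0ℓ ⊔ ℓ)
𝔟 R 𝓘 = LeastSize (Unbounded R 𝓘)
𝔡 R 𝓘 = LeastSize (Dominating R 𝓘)

-- Excluded middle is assumed for all types, not only for propositions: it
-- yields an element of every non-empty type, uniformly, so it also provides
-- the axiom of choice.  Both principles hold in the set-theoretic
-- interpretation of types.
open import Axiom.ExcludedMiddle public using (ExcludedMiddle)
open import Axiom.Extensionality.Propositional public using (Extensionality)

{-# OPTIONS --safe #-}
module Submission where

-- Every inequality 𝔵 ≤ 𝔶 comes from a map which sends each family witnessing
-- 𝔶 to a family witnessing 𝔵.  Along the chains 𝔟(∈*) ≤ 𝔟(≤*) ≤ 𝔟(≠*), and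
-- dually for 𝔡, one uses that a slalom is bounded by the maxima of its
-- members and that x ≤* y implies x ≠* y + 1.  Between 𝔟 and 𝔡, two relations
-- that contradict each other at every point cannot both hold outside sets of
-- the ideal, since two such sets never cover Baire space (by Baire category
-- or by measure); for ∈* against ≠* the contradiction is the guessing
-- argument that n guesses for n values can be turned into one agreement.
-- The comparison of 𝒦 with ℳ holds because compact sets are nowhere dense.
-- That the cardinals exist at all is the well-ordering of cardinals.

open import Defs
open import Axiom.DoubleNegationElimination using (em⇒dne)
open import Data.Bool.Base using (Bool; T; true; false)
open import Data.Bool.Properties using (T-irrelevant)
open import Data.Empty using (⊥; ⊥-elim)
open import Data.Fin.Base using (zero; suc; toℕ)
open import Data.Fin.Properties using (toℕ<n)
open import Data.List.Base using (List; []; _∷_; _++_; length; concatMap)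
open import Data.List.Extrema.Nat using (max; xs≤max; v≤max⁺)
open import Data.List.Membership.Propositional using (lose) renaming (_∈_ to _∈ˡ_)
open import Data.List.Membership.Propositional.Properties using (∈-concatMap⁺)
open import Data.List.Properties using (concatMap-++)
import Data.List.Relation.Unary.All as All
open import Data.List.Relation.Unary.Any using (here; there)
open import Data.List.Relation.Unary.Linked using ([]; [-])
open import Data.Nat.Base as ℕ using (ℕ; zero; suc; z≤n; s≤s)
import Data.Nat.Properties as ℕ
open import Data.Product.Base using (∃; ∃-syntax; _×_; _,_; proj₁; proj₂; map₂)
open import Data.Sum.Base using (_⊎_; inj₁; inj₂)
open import Data.Unit.Base using (⊤; tt)
open import Function.Base using (_∘_; id)
open import Function.Bundles using (_↣_; Injection; mk↣; _⇔_; mk⇔; Equivalence)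
open import Function.Construct.Composition using (_↣-∘_)
open import Level using (Level; 0ℓ)
open import Relation.Binary.PropositionalEquality
open import Relation.Nullary using (¬_; Dec; yes; no; recompute)
open import Relation.Nullary.Decidable using (⌊_⌋; from-yes; toWitness; fromWitness)
open import Relation.Unary using (Pred; _∈_; _⊆_; ∅)

private
  variable
    ℓ ℓ′ : Level
    F G X : Set

-- Boolean values keep the subsets of a small type small, make membership proofs unique, and turn
-- mutual inclusion into equality under extensionality.
Subset : Set → Set
Subset X = X → Bool

infix 4 _∈ˢ_ _⊆ˢ_
_∈ˢ_ : X → Subset X → Set
x ∈ˢ S = T (S x)

_⊆ˢ_ : Subset X → Subset X → Set
S ⊆ˢ S′ = ∀ {x} → x ∈ˢ S → x ∈ˢ S′

-- Maximal cliques and the well-ordering of cardinals.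

module Classical (em : ∀ {ℓ} → ExcludedMiddle ℓ)
                 (ext : ∀ {a b} → Extensionality a b) where

  ¬∀⇒∃¬ : ∀ {a p} {A : Set a} {P : A → Set p} → ¬ (∀ x → P x) → ∃[ x ] ¬ P x
  ¬∀⇒∃¬ ¬∀ = em⇒dne em λ ¬∃ → ¬∀ λ x → em⇒dne em λ ¬Px → ¬∃ (x , ¬Px)

  abstract
    ⟪_⟫ : Pred X ℓ → Subset X
    ⟪ P ⟫ x = ⌊ em {P = P x} ⌋

    ∈⟪⟫⁺ : {P : Pred X ℓ} → ∀ {x} → P x → x ∈ˢ ⟪ P ⟫
    ∈⟪⟫⁺ = fromWitness

    ∈⟪⟫⁻ : {P : Pred X ℓ} → ∀ {x} → x ∈ˢ ⟪ P ⟫ → P x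
    ∈⟪⟫⁻ = toWitness

  ⊆ˢ-antisym : {S S′ : Subset X} → S ⊆ˢ S′ → S′ ⊆ˢ S → S ≡ S′
  ⊆ˢ-antisym {S = S} {S′} S⊆S′ S′⊆S = ext λ x → equal (S x) (S′ x) S⊆S′ S′⊆S
    where
    equal : ∀ b c → (T b → T c) → (T c → T b) → b ≡ c
    equal false false _ _ = refl
    equal false true  _ g = ⊥-elim (g _)
    equal true  false f _ = ⊥-elim (f _)
    equal true  true  _ _ = refl

  -- Zermelo's argument: the sets reached from below by adding one
  -- compatible element at a time and taking unions form a chain, so their
  -- union is a clique, and it admits no further element.
  module MaximalClique {X : Set} (_~_ : X → X → Set)
                       (~-refl : ∀ {x} → x ~ x)
                       (~-sym : ∀ {x y} → x ~ y → y ~ x) where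

    Addable : Subset X → Pred X 0ℓ
    Addable S x = ¬ (x ∈ˢ S) × (∀ y → y ∈ˢ S → x ~ y)

    -- Choice comes from `em`, whose positive answer for `∃ (Addable S)` carries one definite
    -- element. The answer is an argument so that proofs can split on it.
    Added : {S : Subset X} → Dec (∃ (Addable S)) → Pred X 0ℓ
    Added (yes (x , _)) y = y ≡ x
    Added (no _)        y = ⊥

    next : Subset X → Subset X
    next S = ⟪ (λ y → y ∈ˢ S ⊎ Added {S} em y) ⟫

    ⋃ˢ : Subset (Subset X) → Subset X
    ⋃ˢ Φ = ⟪ (λ x → ∃[ S ] S ∈ˢ Φ × x ∈ˢ S) ⟫

    -- The union of the empty `Φ` is the empty set, where the tower starts.
    data Tower : Pred (Subset X) 0ℓ where
      next-Tower : ∀ {S} → Tower S → Tower (next S)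
      ⋃-Tower    : ∀ {Φ} → (∀ {S} → S ∈ˢ Φ → Tower S) → Tower (⋃ˢ Φ)

    ⊆-next : ∀ {S} → S ⊆ˢ next S
    ⊆-next = ∈⟪⟫⁺ ∘ inj₁

    ⊆-⋃ : ∀ {Φ S} → S ∈ˢ Φ → S ⊆ˢ ⋃ˢ Φ
    ⊆-⋃ S∈Φ x∈S = ∈⟪⟫⁺ (_ , S∈Φ , x∈S)

    ⋃-⊆ : ∀ {Φ S′} → (∀ {S} → S ∈ˢ Φ → S ⊆ˢ S′) → ⋃ˢ Φ ⊆ˢ S′
    ⋃-⊆ h x∈⋃ with ∈⟪⟫⁻ x∈⋃
    ... | _ , S∈Φ , x∈S = h S∈Φ x∈S

    -- No step of the tower from properly below `S` jumps past `S`; the first alternative is the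
    -- case of equality.
    Extreme : Pred (Subset X) 0ℓ
    Extreme S = ∀ {S′} → Tower S′ → S′ ⊆ˢ S → S ⊆ˢ S′ ⊎ next S′ ⊆ˢ S

    -- Induction on `S′`. At a successor of a set below `S`, extremality either keeps the successor
    -- below `S` or makes the two sets equal. A union has a member above `next S`, or all its
    -- members lie below `S`.
    extreme⇒comparable : ∀ {S S′} → Extreme S → Tower S′ →
                         S′ ⊆ˢ S ⊎ next S ⊆ˢ S′
    extreme⇒comparable {S} ex (next-Tower {S′} t) with extreme⇒comparable ex t
    ... | inj₂ nS⊆S′ = inj₂ λ {x} → ⊆-next {S′} {x} ∘ nS⊆S′
    ... | inj₁ S′⊆S with ex t S′⊆S
    ...   | inj₂ nS′⊆S = inj₁ nS′⊆S
    ...   | inj₁ S⊆S′ rewrite ⊆ˢ-antisym {S = S} {S′} S⊆S′ S′⊆S = inj₂ id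
    extreme⇒comparable {S} ex (⋃-Tower {Φ} ts)
      with em {P = ∃[ S′ ] S′ ∈ˢ Φ × next S ⊆ˢ S′}
    ... | yes (S′ , S′∈Φ , nS⊆S′) = inj₂ λ {x} → ⊆-⋃ {Φ} S′∈Φ {x} ∘ nS⊆S′
    ... | no ∄ = inj₁ (⋃-⊆ {Φ} λ {S′} S′∈Φ → below S′∈Φ (extreme⇒comparable ex (ts S′∈Φ)))
      where
      below : ∀ {S′} → S′ ∈ˢ Φ → S′ ⊆ˢ S ⊎ next S ⊆ˢ S′ → S′ ⊆ˢ S
      below S′∈Φ (inj₁ S′⊆S) = S′⊆S
      below S′∈Φ (inj₂ nS⊆S′) = ⊥-elim (∄ (_ , S′∈Φ , nS⊆S′))

    extreme : ∀ {S} → Tower S → Extreme S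
    extreme (next-Tower {S} t) {S′} t′ S′⊆nS
      with extreme⇒comparable (extreme t) t′
    ... | inj₂ nS⊆S′ = inj₁ nS⊆S′
    ... | inj₁ S′⊆S with extreme t t′ S′⊆S
    ...   | inj₂ nS′⊆S = inj₂ λ {x} → ⊆-next {S} {x} ∘ nS′⊆S
    ...   | inj₁ S⊆S′ rewrite ⊆ˢ-antisym {S = S} {S′} S⊆S′ S′⊆S = inj₂ id
    extreme (⋃-Tower {Φ} ts) {S′} t′ S′⊆⋃ with em {P = ∃[ S ] S ∈ˢ Φ × S′ ⊆ˢ S}
    ... | no ∄ = inj₁ (⋃-⊆ {Φ} λ {S} S∈Φ →
            below S∈Φ (extreme⇒comparable (extreme (ts S∈Φ)) t′))
      where
      below : ∀ {S} → S ∈ˢ Φ → S′ ⊆ˢ S ⊎ next S ⊆ˢ S′ → S ⊆ˢ S′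
      below S∈Φ (inj₁ S′⊆S) = ⊥-elim (∄ (_ , S∈Φ , S′⊆S))
      below {S} S∈Φ (inj₂ nS⊆S′) {x} = nS⊆S′ ∘ ⊆-next {S} {x}
    ... | yes (S , S∈Φ , S′⊆S) with extreme (ts S∈Φ) t′ S′⊆S
    ...   | inj₂ nS′⊆S = inj₂ λ {x} → ⊆-⋃ {Φ} S∈Φ {x} ∘ nS′⊆S
    -- Here `S′` equals the member `S` of `Φ`, which is extreme and so comparable with the union
    -- itself.
    ...   | inj₁ S⊆S′ rewrite ⊆ˢ-antisym {S = S} {S′} S⊆S′ S′⊆S =
            extreme⇒comparable (extreme (ts S∈Φ)) (⋃-Tower ts)

    chain : ∀ {S S′} → Tower S → Tower S′ → S ⊆ˢ S′ ⊎ S′ ⊆ˢ S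
    chain {S} t t′ with extreme⇒comparable (extreme t) t′
    ... | inj₁ S′⊆S  = inj₂ S′⊆S
    ... | inj₂ nS⊆S′ = inj₁ λ {x} → nS⊆S′ ∘ ⊆-next {S} {x}

    Clique : Pred (Subset X) 0ℓ
    Clique S = ∀ {x y} → x ∈ˢ S → y ∈ˢ S → x ~ y

    tower-clique : ∀ {S} → Tower S → Clique S
    tower-clique (next-Tower {S} t) x∈ y∈ =
      go em (∈⟪⟫⁻ x∈) (∈⟪⟫⁻ y∈)
      where
      go : (d : Dec (∃ (Addable S))) → ∀ {x y} →
           x ∈ˢ S ⊎ Added {S} d x → y ∈ˢ S ⊎ Added {S} d y → x ~ y
      go d (inj₁ x∈S) (inj₁ y∈S) = tower-clique t x∈S y∈S
      go (yes (_ , _ , compat)) (inj₁ x∈S) (inj₂ refl) = ~-sym (compat _ x∈S)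
      go (yes (_ , _ , compat)) (inj₂ refl) (inj₁ y∈S) = compat _ y∈S
      go (yes _) (inj₂ refl) (inj₂ refl) = ~-refl
    tower-clique (⋃-Tower ts) x∈ y∈ with ∈⟪⟫⁻ x∈ | ∈⟪⟫⁻ y∈
    ... | S , S∈Φ , x∈S | S′ , S′∈Φ , y∈S′ with chain (ts S∈Φ) (ts S′∈Φ)
    ...   | inj₁ S⊆S′ = tower-clique (ts S′∈Φ) (S⊆S′ x∈S) y∈S′
    ...   | inj₂ S′⊆S = tower-clique (ts S∈Φ) x∈S (S′⊆S y∈S′)

    maximal : Subset X
    maximal = ⋃ˢ ⟪ Tower ⟫

    maximal-Tower : Tower maximal
    maximal-Tower = ⋃-Tower ∈⟪⟫⁻

    maximal-clique : Clique maximal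
    maximal-clique = tower-clique maximal-Tower

    -- `next maximal` is again in the tower and hence below `maximal`, so it cannot have gained an
    -- element.
    maximal-closed : ∀ {x} → (∀ y → y ∈ˢ maximal → x ~ y) → x ∈ˢ maximal
    -- `go` takes the decision as a variable tied to `em` by `added`, so that a split on it still
    -- speaks about `next maximal`.
    maximal-closed {x} compat = em⇒dne em λ x∉M → go (x , x∉M , compat) em id
      where
      go : ∃ (Addable maximal) → (d : Dec (∃ (Addable maximal))) →
           ¬ (∀ {y} → Added {maximal} d y → Added {maximal} em y)
      go _ (yes (_ , z∉M , _)) added =
        z∉M (⊆-⋃ (∈⟪⟫⁺ (next-Tower maximal-Tower)) (∈⟪⟫⁺ (inj₂ (added refl))))
      go addable (no ∄) _ = ∄ addable

  -- Hönig's proof that cardinals are well-ordered: in a maximal set of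
  -- points of the product of all members of the family that differ in every
  -- coordinate, some coordinate takes all its values.
  leastSize : (P : Pred (Pred F 0ℓ) ℓ) → ∃ P → ∃ (LeastSize P)
  leastSize {F = F} P (A₀ , PA₀) = Y i , (A , PA , A-size) , least
    where
    -- `P` speaks of predicates and need not respect extensional equality, so a code stands for some
    -- `A` in `P` with the same elements. The codes form a small index type.
    Coded : Subset F → Set _
    Coded c = ∃[ A ] P A × (∀ f → f ∈ A ⇔ (f ∈ˢ c))

    I : Set
    I = ∃[ c ] c ∈ˢ ⟪ Coded ⟫

    index : ∀ A → P A → I
    index A PA = ⟪ A ⟫ , ∈⟪⟫⁺ (A , PA , λ f → mk⇔ ∈⟪⟫⁺ ∈⟪⟫⁻)

    Y : I → Set
    Y (c , _) = ∃[ f ] f ∈ˢ c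

    Y-≡ : ∀ {i} {y z : Y i} → proj₁ y ≡ proj₁ z → y ≡ z
    Y-≡ {y = _ , p} {_ , q} refl = cong (_ ,_) (T-irrelevant p q)

    _~_ : (x y : ∀ i → Y i) → Set
    x ~ y = ∀ i → x i ≡ y i → x ≡ y

    open MaximalClique _~_ (λ _ _ → refl) (λ x~y i → sym ∘ x~y i ∘ sym)

    Full : I → Set
    Full i = ∀ y → ∃[ x ] x ∈ˢ maximal × x i ≡ y

    full : ∃ Full
    full = em⇒dne em λ ∄full →
      let missed : ∀ i → ∃[ y ] ¬ (∃[ x ] x ∈ˢ maximal × x i ≡ y)
          missed i = ¬∀⇒∃¬ λ h → ∄full (i , h)
          x = proj₁ ∘ missed
          x∈M = maximal-closed {x} λ y y∈M j xj≡yj →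
                  ⊥-elim (proj₂ (missed j) (y , y∈M , sym xj≡yj))
      -- The point `x` of missed values is itself in the clique; `A₀` provides a coordinate at which
      -- to read off the contradiction.
      in proj₂ (missed (index A₀ PA₀)) (x , x∈M , refl)

    i : I
    i = proj₁ full

    point : Y i → ∀ j → Y j
    point y = proj₁ (proj₂ full y)

    -- Members of the clique that agree at `j` are equal, hence agree at `i`: this embeds `Y i` in
    -- every `Y j`.
    point-injective : ∀ j {y z} → point y j ≡ point z j → y ≡ z
    point-injective j {y} {z} eq =
      let (p , p∈M , pi≡y) = proj₂ full y
          (q , q∈M , qi≡z) = proj₂ full z
      in trans (sym pi≡y) (trans (cong (λ x → x i) (maximal-clique p∈M q∈M j eq)) qi≡z)

    coded : Coded (proj₁ i)
    coded = ∈⟪⟫⁻ (proj₂ i)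

    A = proj₁ coded
    PA = proj₁ (proj₂ coded)

    A-size : HasSize A (Y i)
    A-size = mk↣ (Y-≡ {i}) , λ f → let open Equivalence (proj₂ (proj₂ coded) f) in
      mk⇔ (λ f∈A → (f , to f∈A) , refl) λ { ((_ , f∈c) , refl) → from f∈c }

    least : ∀ B θ → P B → HasSize B θ → Y i ↣ θ
    least B θ PB (e , B⇔) = mk↣ {to = proj₁ ∘ preimage} λ {y} {z} eq →
      point-injective j (Y-≡ {j} (trans (sym (proj₂ (preimage y)))
        (trans (cong (Injection.to e) eq) (proj₂ (preimage z)))))
      where
      j = index B PB
      preimage : ∀ y → ∃[ k ] Injection.to e k ≡ proj₁ (point y j)
      preimage y = Equivalence.to (B⇔ _) (∈⟪⟫⁻ (proj₂ (point y j)))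

  -- Comparing least sizes through images of families.

  image : (F → G) → Pred F 0ℓ → Pred G 0ℓ
  image φ A g = ∃[ f ] f ∈ A × φ f ≡ g

  -- Elements of `κ` carry only a Boolean truth, from which `∈⟪⟫⁻` recovers one definite preimage;
  -- distinct elements have distinct preimages.
  image-size : (φ : F → G) {A : Pred F 0ℓ} {θ : Set} → HasSize A θ →
               ∃[ κ ] HasSize (image φ A) κ × (κ ↣ θ)
  image-size {G = G} φ {A} {θ} (e , A⇔) =
    κ , (mk↣ κ-≡ , image⇔) , mk↣ {to = proj₁ ∘ preimage} λ {y} {z} eq →
      κ-≡ (trans (sym (proj₂ (preimage y)))
        (trans (cong (φ ∘ Injection.to e) eq) (proj₂ (preimage z))))
    where
    κ = ∃[ g ] g ∈ˢ ⟪ image φ A ⟫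

    κ-≡ : {y z : κ} → proj₁ y ≡ proj₁ z → y ≡ z
    κ-≡ {_ , p} {_ , q} refl = cong (_ ,_) (T-irrelevant p q)

    image⇔ : ∀ g → (g ∈ image φ A) ⇔ (∃[ y ] proj₁ y ≡ g)
    image⇔ g = mk⇔ (λ g∈ → (g , ∈⟪⟫⁺ g∈) , refl) λ { ((_ , g∈) , refl) → ∈⟪⟫⁻ g∈ }

    preimage : (y : κ) → ∃[ k ] φ (Injection.to e k) ≡ proj₁ y
    preimage (g , g∈) with ∈⟪⟫⁻ g∈
    ... | f , f∈A , refl with Equivalence.to (A⇔ f) f∈A
    ...   | k , refl = k , refl

  -- The image of a smallest family for `Q` is a family for `P`, so the least size for `P` embeds in
  -- the image, and the image embeds in its source.
  ≼-image : {P : Pred (Pred G 0ℓ) ℓ} {Q : Pred (Pred F 0ℓ) ℓ′} (φ : F → G) →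
            (∀ {A} → Q A → P (image φ A)) → ∃ Q → LeastSize P ≼ LeastSize Q
  ≼-image {P = P} {Q} φ Q⇒P (A , QA)
    with leastSize P (image φ A , Q⇒P QA) | leastSize Q (A , QA)
  ... | κ , κ-least | θ , θ-least@((B , QB , B-size) , _)
    with image-size φ B-size
  ... | κ′ , size , κ′↣θ =
    κ , θ , κ-least , θ-least , (κ′↣θ ↣-∘ proj₂ κ-least _ _ (Q⇒P QB) size)

-- The last field stands in for closure under unions: Baire space is not the
-- union of two members of the ideal.
record IsProperIdeal (𝓘 : Ideal ℓ) : Set (Level.suc 0ℓ Level.⊔ ℓ) where
  field
    ⊆-closed : ∀ {A B} → A ⊆ B → B ∈ 𝓘 → A ∈ 𝓘
    ∅-member : ∅ ∈ 𝓘
    proper   : ∀ {A B} → A ∈ 𝓘 → B ∈ 𝓘 → ∃[ x ] ¬ (x ∈ A) × ¬ (x ∈ B)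

-- Baire space is not the union of two null sets.

module Nullity (em : ∀ {ℓ} → ExcludedMiddle ℓ)
               (ext : ∀ {a b} → Extensionality a b) where
  import Data.Integer.Base as ℤ
  import Data.Integer.Properties as ℤ
  open import Data.Rational.Base
  open import Data.Rational.Properties
  open import Data.Rational.Solver using (module +-*-Solver)
  import Data.Rational.Unnormalised.Base as ℚᵘ
  import Data.Rational.Unnormalised.Properties as ℚᵘ
  open Classical em ext

  ½^-positive : ∀ n → Positive (½^ n)
  ½^-positive zero    = _
  ½^-positive (suc n) = pos*pos⇒pos ½ (½^ n) {{½^-positive n}}

  ½^-nonNegative : ∀ n → NonNegative (½^ n)
  ½^-nonNegative n = pos⇒nonNeg (½^ n) {{½^-positive n}}

  μN-nonNegative : ∀ c → NonNegative (μN c)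
  μN-nonNegative []      = _
  μN-nonNegative (k ∷ c) =
    nonNeg*nonNeg⇒nonNeg (½^ (suc k)) {{½^-nonNegative (suc k)}} (μN c) {{μN-nonNegative c}}

  0≤μN : ∀ c → 0ℚ ≤ μN c
  0≤μN c = nonNegative⁻¹ (μN c) {{μN-nonNegative c}}

  p≤p+q : ∀ p {q} → 0ℚ ≤ q → p ≤ p + q
  p≤p+q p 0≤q = ≤-trans (≤-reflexive (sym (+-identityʳ p))) (+-monoʳ-≤ p 0≤q)

  ½^-suc+½^-suc : ∀ n → ½^ (suc n) + ½^ (suc n) ≡ ½^ n
  ½^-suc+½^-suc n = trans (sym (*-distribʳ-+ (½^ n) ½ ½)) (*-identityˡ (½^ n))

  ∑<-mono : ∀ m {a b} → (∀ k → k ℕ.< m → a k ≤ b k) → ∑< m a ≤ ∑< m b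
  ∑<-mono zero    a≤b = ≤-refl
  ∑<-mono (suc m) a≤b = +-mono-≤ (∑<-mono m λ k k<m → a≤b k (ℕ.m≤n⇒m≤1+n k<m)) (a≤b m ℕ.≤-refl)

  ∑<-cong : ∀ m {a b} → (∀ k → a k ≡ b k) → ∑< m a ≡ ∑< m b
  ∑<-cong zero    a≡b = refl
  ∑<-cong (suc m) a≡b = cong₂ _+_ (∑<-cong m a≡b) (a≡b m)

  ∑<-+ : ∀ m a b → ∑< m (λ k → a k + b k) ≡ ∑< m a + ∑< m b
  ∑<-+ zero    a b = refl
  ∑<-+ (suc m) a b rewrite ∑<-+ m a b =
    solve 4 (λ s t x y → (s :+ t) :+ (x :+ y) := (s :+ x) :+ (t :+ y)) refl
      (∑< m a) (∑< m b) (a m) (b m)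
    where open +-*-Solver

  ∑<-*ʳ : ∀ m a q → ∑< m (λ k → a k * q) ≡ ∑< m a * q
  ∑<-*ʳ zero    a q = sym (*-zeroˡ q)
  ∑<-*ʳ (suc m) a q rewrite ∑<-*ʳ m a q = sym (*-distribʳ-+ q (∑< m a) (a m))

  ∑<-0 : ∀ m {a} → (∀ k → k ℕ.< m → a k ≡ 0ℚ) → ∑< m a ≡ 0ℚ
  ∑<-0 zero    a≡0 = refl
  ∑<-0 (suc m) a≡0 rewrite ∑<-0 m (λ k k<m → a≡0 k (ℕ.m≤n⇒m≤1+n k<m)) | a≡0 m ℕ.≤-refl = refl

  -- Geometric series with its tail kept as an explicit term, which avoids limits.
  ∑<-½^ : ∀ m k → ∑< m (λ i → ½^ (suc (k ℕ.+ i))) + ½^ (k ℕ.+ m) ≡ ½^ k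
  ∑<-½^ zero    k = trans (+-identityˡ _) (cong ½^ (ℕ.+-identityʳ k))
  ∑<-½^ (suc m) k = begin
    (σ + ½^ (suc (k ℕ.+ m))) + ½^ (k ℕ.+ suc m)
      ≡⟨ cong (λ n → (σ + ½^ (suc (k ℕ.+ m))) + ½^ n) (ℕ.+-suc k m) ⟩
    (σ + ½^ (suc (k ℕ.+ m))) + ½^ (suc (k ℕ.+ m))   ≡⟨ +-assoc σ _ _ ⟩
    σ + (½^ (suc (k ℕ.+ m)) + ½^ (suc (k ℕ.+ m)))   ≡⟨ cong (σ +_) (½^-suc+½^-suc (k ℕ.+ m)) ⟩
    σ + ½^ (k ℕ.+ m)                                ≡⟨ ∑<-½^ m k ⟩
    ½^ k                                            ∎
    where
    open ≡-Reasoning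
    σ = ∑< m (λ i → ½^ (suc (k ℕ.+ i)))

  ½^≤1/suc : ∀ n → toℚᵘ (½^ n) ℚᵘ.≤ ℚᵘ.mkℚᵘ (ℤ.+ 1) n
  ½^≤1/suc zero    = ℚᵘ.≤-refl
  ½^≤1/suc (suc n) = begin
    toℚᵘ (½ * ½^ n)                    ≃⟨ toℚᵘ-homo-* ½ (½^ n) ⟩
    toℚᵘ ½ ℚᵘ.* toℚᵘ (½^ n)            ≤⟨ ℚᵘ.*-monoʳ-≤-nonNeg (toℚᵘ ½) (½^≤1/suc n) ⟩
    toℚᵘ ½ ℚᵘ.* ℚᵘ.mkℚᵘ (ℤ.+ 1) n        ≤⟨ ℚᵘ.*≤* (ℤ.+≤+ (ℕ.s≤s le)) ⟩
    ℚᵘ.mkℚᵘ (ℤ.+ 1) (suc n)              ∎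
    where
    open ℚᵘ.≤-Reasoning
    le : suc n ℕ.+ 0 ℕ.≤ n ℕ.+ suc (n ℕ.+ 0) ℕ.+ 0
    le = ℕ.≤-trans (ℕ.m≤n+m (suc n ℕ.+ 0) n) (ℕ.m≤m+n (n ℕ.+ suc (n ℕ.+ 0)) 0)

  -- A positive rational with denominator `suc d` has numerator at least 1, so it is at least
  -- 1/(d+1) and hence at least `½^ d`.
  archimedean : ∀ ε → 0ℚ < ε → ∃[ k ] ½^ k ≤ ε
  archimedean (mkℚ ℤ.+[1+ n ]   d _) _           = d , toℚᵘ-cancel-≤
    (ℚᵘ.≤-trans (½^≤1/suc d) (ℚᵘ.*≤* (ℤ.*-monoʳ-≤-nonNeg (ℤ.+ suc d) (ℤ.+≤+ (ℕ.s≤s (ℕ.z≤n {n}))))))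
  archimedean (mkℚ (ℤ.+ zero)   d _) (*<* (ℤ.+<+ ()))
  archimedean (mkℚ ℤ.-[1+ n ]   d _) (*<* ())

  weight : List (List ℕ) → ℚ
  weight []       = 0ℚ
  weight (c ∷ cs) = μN c + weight cs

  weight-++ : ∀ cs ds → weight (cs ++ ds) ≡ weight cs + weight ds
  weight-++ []       ds = sym (+-identityˡ (weight ds))
  weight-++ (c ∷ cs) ds rewrite weight-++ cs ds = sym (+-assoc (μN c) (weight cs) (weight ds))

  0≤weight : ∀ cs → 0ℚ ≤ weight cs
  0≤weight []       = ≤-refl
  0≤weight (c ∷ cs) = +-mono-≤ (0≤μN c) (0≤weight cs)

  μN≤weight : ∀ {c cs} → c ∈ˡ cs → μN c ≤ weight cs
  μN≤weight {c} {cs = _ ∷ cs} (here refl) = p≤p+q (μN c) (0≤weight cs)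
  μN≤weight {cs = d ∷ cs} (there c∈) =
    ≤-trans (μN≤weight c∈)
      (≤-trans (p≤p+q (weight cs) (0≤μN d)) (≤-reflexive (+-comm (weight cs) (μN d))))

  -- The trace of N c on N (k ∷ []), with the first coordinate removed.
  trace : ℕ → List ℕ → List (List ℕ)
  trace k []      = [] ∷ []
  trace k (j ∷ c) with j ℕ.≟ k
  ... | yes _ = c ∷ []
  ... | no  _ = []

  ∈-trace : ∀ {j k} c → j ≡ k → c ∈ˡ trace k (j ∷ c)
  ∈-trace {j} {k} c j≡k with j ℕ.≟ k
  ... | yes _  = here refl
  ... | no j≢k = ⊥-elim (j≢k j≡k)

  traces : ℕ → List (List ℕ) → List (List ℕ)
  traces k = concatMap (trace k)

  -- Fubini for one basic set along the first coordinate; an inequality, as only finitely many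
  -- sections are summed.
  ∑-trace : ∀ m c → ∑< m (λ k → ½^ (suc k) * weight (trace k c)) ≤ μN c
  ∑-trace m [] = begin
    ∑< m (λ k → ½^ (suc k) * (1ℚ + 0ℚ))   ≡⟨ ∑<-cong m (λ k → *-identityʳ (½^ (suc k))) ⟩
    ∑< m (λ k → ½^ (suc k))               ≤⟨ p≤p+q _ (nonNegative⁻¹ (½^ m) {{½^-nonNegative m}}) ⟩
    ∑< m (λ k → ½^ (suc k)) + ½^ m        ≡⟨ ∑<-½^ m 0 ⟩
    1ℚ                                    ∎
    where open ≤-Reasoning
  ∑-trace m (j ∷ c) = go m
    where
    a : ℕ → ℚ
    a k = ½^ (suc k) * weight (trace k (j ∷ c))

    a-≢ : ∀ k → j ≢ k → a k ≡ 0ℚ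
    a-≢ k j≢k with j ℕ.≟ k
    ... | yes j≡k = ⊥-elim (j≢k j≡k)
    ... | no  _   = *-zeroʳ (½^ (suc k))

    a-≡ : a j ≡ μN (j ∷ c)
    a-≡ with j ℕ.≟ j
    ... | yes _  = cong (½^ (suc j) *_) (+-identityʳ (μN c))
    ... | no j≢j = ⊥-elim (j≢j refl)

    go : ∀ m → ∑< m a ≤ μN (j ∷ c)
    go zero    = 0≤μN (j ∷ c)
    go (suc m) = last (j ℕ.≟ m)
      where
      open ≤-Reasoning
      last : Dec (j ≡ m) → ∑< m a + a m ≤ μN (j ∷ c)
      last (no j≢m) = begin
        ∑< m a + a m    ≡⟨ cong (∑< m a +_) (a-≢ m j≢m) ⟩
        ∑< m a + 0ℚ     ≡⟨ +-identityʳ (∑< m a) ⟩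
        ∑< m a          ≤⟨ go m ⟩
        μN (j ∷ c)      ∎
      last (yes refl) = begin
        ∑< j a + a j    ≡⟨ cong₂ _+_ (∑<-0 j λ k k<j → a-≢ k (ℕ.<⇒≢ k<j ∘ sym)) a-≡ ⟩
        0ℚ + μN (j ∷ c) ≡⟨ +-identityˡ _ ⟩
        μN (j ∷ c)      ∎

  ∑-traces : ∀ m cs → ∑< m (λ k → ½^ (suc k) * weight (traces k cs)) ≤ weight cs
  ∑-traces m []       = ≤-reflexive (∑<-0 m λ k _ → *-zeroʳ (½^ (suc k)))
  ∑-traces m (c ∷ cs) = begin
    ∑< m (λ k → ½^ (suc k) * weight (trace k c ++ traces k cs))
      ≡⟨ ∑<-cong m (λ k → trans (cong (½^ (suc k) *_) (weight-++ (trace k c) (traces k cs)))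
                                (*-distribˡ-+ (½^ (suc k)) _ _)) ⟩
    ∑< m (λ k → ½^ (suc k) * weight (trace k c) + ½^ (suc k) * weight (traces k cs))
      ≡⟨ ∑<-+ m _ _ ⟩
    ∑< m (λ k → ½^ (suc k) * weight (trace k c)) + ∑< m (λ k → ½^ (suc k) * weight (traces k cs))
      ≤⟨ +-mono-≤ (∑-trace m c) (∑-traces m cs) ⟩
    μN c + weight cs ∎
    where open ≤-Reasoning

  Cover : Set
  Cover = ℕ → List (List ℕ)

  initial : Cover → ℕ → List (List ℕ)
  initial e zero    = []
  initial e (suc m) = e m ++ initial e m

  initial-traces : ∀ k e m → initial (traces k ∘ e) m ≡ traces k (initial e m)
  initial-traces k e zero    = refl
  initial-traces k e (suc m) rewrite initial-traces k e m =
    sym (concatMap-++ (trace k) (e m) (initial e m))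

  weight-initial-mono : ∀ e {m n} → m ℕ.≤ n → weight (initial e m) ≤ weight (initial e n)
  weight-initial-mono e {m} {n} m≤n = go (ℕ.≤⇒≤′ m≤n)
    where
    go : ∀ {n} → m ℕ.≤′ n → weight (initial e m) ≤ weight (initial e n)
    go ℕ.≤′-refl = ≤-refl
    go {suc n} (ℕ.≤′-step m≤n) = begin
      weight (initial e m)                 ≤⟨ go m≤n ⟩
      weight (initial e n)                 ≤⟨ p≤p+q (weight (initial e n)) (0≤weight (e n)) ⟩
      weight (initial e n) + weight (e n)  ≡⟨ +-comm _ (weight (e n)) ⟩
      weight (e n) + weight (initial e n)  ≡⟨ weight-++ (e n) (initial e n) ⟨
      weight (e n ++ initial e n)          ∎
      where open ≤-Reasoning

  -- The total measure of the cover is at most 1 - b, expressed through its finite stages.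
  Slack : ℚ → Pred Cover 0ℓ
  Slack b e = ∀ m → weight (initial e m) + b ≤ 1ℚ

  commonBound : ∀ (f : ℕ → ℕ) m → ∃[ n ] (∀ k → k ℕ.< m → f k ℕ.≤ n)
  commonBound f zero    = 0 , λ _ ()
  commonBound f (suc m) with commonBound f m
  ... | n , f≤n = n ℕ.⊔ f m , bound
    where
    bound : ∀ k → k ℕ.< suc m → f k ℕ.≤ n ℕ.⊔ f m
    bound k (ℕ.s≤s k≤m) with ℕ.m≤n⇒m<n∨m≡n k≤m
    ... | inj₁ k<m  = ℕ.≤-trans (f≤n k k<m) (ℕ.m≤m⊔n n (f m))
    ... | inj₂ refl = ℕ.m≤n⊔m n (f m)

  -- If no trace had slack b = ½^ (suc n), then averaging over
  -- the first suc n traces, of total measure 1 − b, would give weight at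
  -- least (1 − b)² > 1 − 2b at some finite stage.
  slack-step : ∀ n e → Slack (½^ n) e → ∃[ k ] Slack (½^ (suc n)) (traces k ∘ e)
  slack-step n e slack = em⇒dne em λ ∄k →
    let exceeds : ∀ k → ∃[ m ] ¬ (weight (initial (traces k ∘ e) m) + b ≤ 1ℚ)
        exceeds k = ¬∀⇒∃¬ λ s → ∄k (k , s)
        -- Weights grow with the stage, so one stage `M` serves the first `suc n` traces together.
        M , ≤M = commonBound (proj₁ ∘ exceeds) (suc n)
        W = weight (initial e M)
        w = λ k → weight (traces k (initial e M))
        1≤ : ∀ k → k ℕ.< suc n → 1ℚ ≤ w k + b
        1≤ k k<n = ≤-trans (<⇒≤ (≰⇒> (proj₂ (exceeds k))))
          (+-monoˡ-≤ b (≤-trans (weight-initial-mono (traces k ∘ e) (≤M k k<n))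
            (≤-reflexive (cong weight (initial-traces k e M)))))
        σ≤ : σ ≤ W + σ * b
        σ≤ = begin
          ∑< (suc n) (λ k → ½^ (suc k))
            ≤⟨ ∑<-mono (suc n) (λ k k<n → ≤-trans (≤-reflexive (sym (*-identityʳ (½^ (suc k)))))
                 (*-monoˡ-≤-nonNeg (½^ (suc k)) {{½^-nonNegative (suc k)}} (1≤ k k<n))) ⟩
          ∑< (suc n) (λ k → ½^ (suc k) * (w k + b))
            ≡⟨ ∑<-cong (suc n) (λ k → *-distribˡ-+ (½^ (suc k)) (w k) b) ⟩
          ∑< (suc n) (λ k → ½^ (suc k) * w k + ½^ (suc k) * b)
            ≡⟨ ∑<-+ (suc n) _ _ ⟩
          ∑< (suc n) (λ k → ½^ (suc k) * w k) + ∑< (suc n) (λ k → ½^ (suc k) * b)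
            ≤⟨ +-mono-≤ (∑-traces (suc n) (initial e M)) (≤-reflexive (∑<-*ʳ (suc n) _ b)) ⟩
          W + σ * b ∎
        absurd : σ + (b + b) < σ + (b + b)
        absurd = begin-strict
          σ + (b + b)                   ≡⟨ +-identityʳ _ ⟨
          (σ + (b + b)) + 0ℚ
            <⟨ +-monoʳ-< (σ + (b + b)) (positive⁻¹ (b * b) {{pos*pos⇒pos b {{b>0}} b {{b>0}}}}) ⟩
          (σ + (b + b)) + b * b         ≤⟨ +-monoˡ-≤ (b * b) (+-monoˡ-≤ (b + b) σ≤) ⟩
          ((W + σ * b) + (b + b)) + b * b
            ≡⟨ solve 3 (λ W σ b → ((W :+ σ :* b) :+ (b :+ b)) :+ b :* b
                                  := (W :+ (b :+ b)) :+ (σ :+ b) :* b) refl W σ b ⟩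
          (W + (b + b)) + (σ + b) * b   ≡⟨ cong₂ (λ p q → (W + p) + q * b) (½^-suc+½^-suc n) σ+b ⟩
          (W + ½^ n) + 1ℚ * b           ≤⟨ +-monoˡ-≤ (1ℚ * b) (slack M) ⟩
          1ℚ + 1ℚ * b                   ≡⟨ cong₂ _+_ (sym σ+b) (*-identityˡ b) ⟩
          (σ + b) + b                   ≡⟨ +-assoc σ b b ⟩
          σ + (b + b)                   ∎
    in <-irrefl refl absurd
    where
    open ≤-Reasoning
    open +-*-Solver
    b = ½^ (suc n)
    b>0 = ½^-positive (suc n)
    σ = ∑< (suc n) (λ k → ½^ (suc k))
    σ+b : σ + b ≡ 1ℚ
    σ+b = ∑<-½^ (suc n) 0

  Slacking : Set
  Slacking = ∃[ n ] ∃ (Slack (½^ n))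

  branch : Slacking → ℕ
  branch (n , e , slack) = proj₁ (slack-step n e slack)

  descend : Slacking → Slacking
  descend (n , e , slack) = suc n , _ , proj₂ (slack-step n e slack)

  path : Slacking → Baire
  path t zero    = branch t
  path t (suc i) = path (descend t) i

  -- Each coordinate of the path strips one from `c`. If the path were in `N c`, the trace of `c`
  -- would survive down to the whole space, whose weight 1 contradicts positive slack.
  path-uncovered : ∀ t i {c} → c ∈ˡ proj₁ (proj₂ t) i → ¬ (path t ∈ N c)
  path-uncovered (n , e , slack) i {[]} c∈ _ = <-irrefl refl (begin-strict
    1ℚ                                    ≤⟨ μN≤weight c∈ ⟩
    weight (e i)                          ≤⟨ p≤p+q (weight (e i)) (0≤weight (initial e i)) ⟩
    weight (e i) + weight (initial e i)   ≡⟨ weight-++ (e i) (initial e i) ⟨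
    weight (initial e (suc i))            ≡⟨ +-identityʳ (weight (initial e (suc i))) ⟨
    weight (initial e (suc i)) + 0ℚ
      <⟨ +-monoʳ-< (weight (initial e (suc i))) (positive⁻¹ (½^ n) {{½^-positive n}}) ⟩
    weight (initial e (suc i)) + ½^ n     ≤⟨ slack (suc i) ⟩
    1ℚ                                    ∎)
    where open ≤-Reasoning
  path-uncovered t i {j ∷ c} c∈ p∈N =
    path-uncovered (descend t) i
      (∈-concatMap⁺ (trace (branch t)) (lose c∈ (∈-trace c (sym (p∈N zero))))) (p∈N ∘ suc)

  -- A cover consists of infinitely many basic sets, each of positive measure, so even the empty set
  -- needs a sequence with small total.
  ∅∈𝒩 : ∅ ∈ 𝒩
  ∅∈𝒩 ε 0<ε with archimedean ε 0<ε
  ... | k , ½^k≤ε = (λ i → k ℕ.+ i ∷ []) , (λ ()) , λ m → begin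
    ∑< m (λ i → ½^ (suc (k ℕ.+ i)) * 1ℚ)
      ≡⟨ ∑<-cong m (λ i → *-identityʳ (½^ (suc (k ℕ.+ i)))) ⟩
    ∑< m (λ i → ½^ (suc (k ℕ.+ i)))
      ≤⟨ p≤p+q (∑< m (λ i → ½^ (suc (k ℕ.+ i))))
           (nonNegative⁻¹ (½^ (k ℕ.+ m)) {{½^-nonNegative (k ℕ.+ m)}}) ⟩
    ∑< m (λ i → ½^ (suc (k ℕ.+ i))) + ½^ (k ℕ.+ m)
      ≡⟨ ∑<-½^ m k ⟩
    ½^ k       ≤⟨ ½^k≤ε ⟩
    ε          ≡⟨ +-identityˡ ε ⟨
    0ℚ + ε     ∎
    where open ≤-Reasoning

  𝒩-proper : IsProperIdeal 𝒩
  𝒩-proper = record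
    { ⊆-closed = λ A⊆B null ε 0<ε → let c , B⊆ , small = null ε 0<ε in c , B⊆ ∘ A⊆B , small
    ; ∅-member = ∅∈𝒩
    ; proper   = uncovered
    }
    where
    uncovered : ∀ {A B} → A ∈ 𝒩 → B ∈ 𝒩 → ∃[ x ] ¬ (x ∈ A) × ¬ (x ∈ B)
    uncovered A-null B-null = path t
      , (λ x∈A → let i , x∈N = A⊆ x∈A in path-uncovered t i (here refl) x∈N)
      , (λ x∈B → let i , x∈N = B⊆ x∈B in path-uncovered t i (there (here refl)) x∈N)
      where
      open ≤-Reasoning
      -- A quarter for each set leaves the merged cover with slack `½^ 1`.
      coverA = A-null (½^ 2) (from-yes (0ℚ <? ½^ 2))
      coverB = B-null (½^ 2) (from-yes (0ℚ <? ½^ 2))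
      c = proj₁ coverA
      d = proj₁ coverB
      A⊆ = proj₁ (proj₂ coverA)
      B⊆ = proj₁ (proj₂ coverB)

      e : Cover
      e i = c i ∷ d i ∷ []

      weight-e : ∀ m → weight (initial e m) ≡ ∑< m (μN ∘ c) + ∑< m (μN ∘ d)
      weight-e zero    = refl
      weight-e (suc m) rewrite weight-e m =
        solve 4 (λ p q s t → p :+ (q :+ (s :+ t)) := (s :+ p) :+ (t :+ q)) refl
          (μN (c m)) (μN (d m)) (∑< m (μN ∘ c)) (∑< m (μN ∘ d))
        where open +-*-Solver

      t : Slacking
      t = 1 , e , λ m → begin
        weight (initial e m) + ½^ 1                   ≡⟨ cong (_+ ½^ 1) (weight-e m) ⟩
        (∑< m (μN ∘ c) + ∑< m (μN ∘ d)) + ½^ 1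
          ≤⟨ +-monoˡ-≤ (½^ 1) (+-mono-≤ (proj₂ (proj₂ coverA) m) (proj₂ (proj₂ coverB) m)) ⟩
        ((0ℚ + ½^ 2) + (0ℚ + ½^ 2)) + ½^ 1            ≡⟨⟩
        1ℚ                                            ∎

-- Baire category, and compact sets as nowhere dense sets.

module Category (em : ∀ {ℓ} → ExcludedMiddle ℓ)
                (ext : ∀ {a b} → Extensionality a b) where
  open import Data.Nat.Base using (_+_; _⊔_; _≤_; _<_)
  open import Data.Nat.Properties
  open Classical em ext

  infix 4 _≈[_]_
  _≈[_]_ : Baire → ℕ → Baire → Set
  y ≈[ n ] x = ∀ i → i < n → y i ≡ x i

  ≈-weaken : ∀ {m n x y} → m ≤ n → y ≈[ n ] x → y ≈[ m ] x
  ≈-weaken m≤n y≈x i i<m = y≈x i (<-≤-trans i<m m≤n)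

  ≈-trans : ∀ {n x y z} → z ≈[ n ] y → y ≈[ n ] x → z ≈[ n ] x
  ≈-trans z≈y y≈x i i<n = trans (z≈y i i<n) (y≈x i i<n)

  restrict : ℕ → Baire → List ℕ
  restrict zero    x = []
  restrict (suc n) x = x 0 ∷ restrict n (x ∘ suc)

  ∈N-restrict⁺ : ∀ n x y → y ≈[ n ] x → y ∈ N (restrict n x)
  ∈N-restrict⁺ (suc n) x y y≈x zero    = y≈x 0 (s≤s z≤n)
  ∈N-restrict⁺ (suc n) x y y≈x (suc i) =
    ∈N-restrict⁺ n (x ∘ suc) (y ∘ suc) (λ i i<n → y≈x (suc i) (s≤s i<n)) i

  ∈N-restrict⁻ : ∀ n x y → y ∈ N (restrict n x) → y ≈[ n ] x
  ∈N-restrict⁻ (suc n) x y y∈N zero    _         = y∈N zero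
  ∈N-restrict⁻ (suc n) x y y∈N (suc i) (s≤s i<n) =
    ∈N-restrict⁻ n (x ∘ suc) (y ∘ suc) (y∈N ∘ suc) i i<n

  ∈N-resp-≈ : ∀ s x y → y ≈[ length s ] x → x ∈ N s → y ∈ N s
  ∈N-resp-≈ s x y y≈x x∈N i = trans (y≈x (toℕ i) (toℕ<n i)) (x∈N i)

  Avoids : Pred Baire 0ℓ → ℕ → Pred Baire 0ℓ
  Avoids D n x = ∀ y → y ≈[ n ] x → ¬ (y ∈ D)

  ∅-nowhereDense : NowhereDense ∅
  ∅-nowhereDense x (s , x∈N , N⊆) with N⊆ {x} x∈N [] (λ ())
  ... | _ , _ , ()

  ∅-compact : IsCompact ∅
  ∅-compact U _ _ = [] , λ _ ()

  -- The open sets on which coordinate `n` is at most `k` cover the space; the largest index in a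
  -- finite subcover is the bound.
  compact-bounded : ∀ {C} → IsCompact C → ∀ n → ∃[ b ] (∀ x → x ∈ C → x n ≤ b)
  compact-bounded {C} compact n with compact U U-open (λ {x} _ → x n , ≤-refl)
    where
    U : ℕ → Pred Baire 0ℓ
    U k x = x n ≤ k
    U-open : ∀ k → IsOpen (U k)
    U-open k x xn≤k = restrict (suc n) x , ∈N-restrict⁺ (suc n) x x (λ _ _ → refl) ,
      λ {y} y∈N → subst (_≤ k) (sym (∈N-restrict⁻ (suc n) x y y∈N n ≤-refl)) xn≤k
  ... | ks , covers = max 0 ks , λ x x∈C → v≤max⁺ 0 ks (inj₂ (covers x x∈C))

  -- Every N s contains a point whose value at length s exceeds the bound there.
  compact⇒nowhereDense : ∀ {C} → IsCompact C → NowhereDense C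
  compact⇒nowhereDense {C} compact x (s , x∈N , N⊆) =
    1+n≰n (≤-trans (≤-reflexive (sym zn≡)) (bound z z∈C))
    where
    n = length s
    b = proj₁ (compact-bounded compact n)
    bound = proj₂ (compact-bounded compact n)
    y : Baire
    y i with i ≟ n
    ... | yes _ = suc b
    ... | no  _ = x i
    yn≡ : y n ≡ suc b
    yn≡ with n ≟ n
    ... | yes _  = refl
    ... | no n≢n = ⊥-elim (n≢n refl)
    y≈x : y ≈[ n ] x
    y≈x i i<n with i ≟ n
    ... | yes i≡n = ⊥-elim (<⇒≢ i<n i≡n)
    ... | no _    = refl
    near = N⊆ {y} (∈N-resp-≈ s x y y≈x x∈N)
             (restrict (suc n) y) (∈N-restrict⁺ (suc n) y y (λ _ _ → refl))
    z = proj₁ near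
    z∈C = proj₂ (proj₂ near)
    zn≡ : z n ≡ suc b
    zn≡ = trans (∈N-restrict⁻ (suc n) y z (proj₁ (proj₂ near)) n ≤-refl) yn≡

  𝒦⊆ℳ : 𝒦 ⊆ ℳ
  𝒦⊆ℳ (B , (C , compact , B⊆ , _) , A⊆B) =
    C , (λ n → compact⇒nowhereDense (compact n)) , B⊆ ∘ A⊆B

  -- Some `y` in the neighbourhood given by `n` and `x` lies off the closure of `D`, so a basic set
  -- around `y` misses `D`. The new depth covers both constraints, and its `suc` makes it strictly
  -- larger.
  avoid : ∀ {D} → NowhereDense D → ∀ n x →
          ∃[ n′ ] ∃[ x′ ] n < n′ × x′ ≈[ n ] x × Avoids D n′ x′
  avoid {D} nd n x =
    let N⊈ : ∃[ y ] ¬ (y ∈ N (restrict n x) → y ∈ Closure D)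
        N⊈ = ¬∀⇒∃¬ λ N⊆ → nd x (restrict n x , ∈N-restrict⁺ n x x (λ _ _ → refl) , λ {y} → N⊆ y)
        y , ¬imp = N⊈
        y∈N = em⇒dne em λ y∉N → ¬imp λ y∈N → ⊥-elim (y∉N y∈N)
        s , ¬meets = ¬∀⇒∃¬ {P = λ s → y ∈ N s → ∃[ z ] z ∈ N s × z ∈ D} λ y∈cl → ¬imp λ _ → y∈cl
        y∈Ns = em⇒dne em λ y∉N → ¬meets λ y∈N → ⊥-elim (y∉N y∈N)
    in suc (n ⊔ length s) , y , s≤s (m≤m⊔n n (length s)) , ∈N-restrict⁻ n x y y∈N ,
       λ z z≈y z∈D → ¬meets λ _ →
         z , ∈N-resp-≈ s y z (≈-weaken (m≤n⇒m≤1+n (m≤n⊔m n (length s))) z≈y) y∈Ns , z∈D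

  avoid₂ : ∀ {D E} → NowhereDense D → NowhereDense E → ∀ n x →
           ∃[ n′ ] ∃[ x′ ] n < n′ × x′ ≈[ n ] x × Avoids D n′ x′ × Avoids E n′ x′
  avoid₂ D-nd E-nd n x =
    let n₁ , x₁ , n<n₁ , x₁≈x , D-avoided = avoid D-nd n x
        n₂ , x₂ , n₁<n₂ , x₂≈x₁ , E-avoided = avoid E-nd n₁ x₁
    in n₂ , x₂ , <-trans n<n₁ n₁<n₂ , ≈-trans (≈-weaken (<⇒≤ n<n₁) x₂≈x₁) x₁≈x ,
       (λ y y≈x₂ → D-avoided y (≈-trans (≈-weaken (<⇒≤ n₁<n₂) y≈x₂) x₂≈x₁)) , E-avoided

  -- Stage `n` avoids `D n` and `E n` on a whole neighbourhood; the later stages stay inside it, and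
  -- so does the limit.
  baire : ∀ {D E : ℕ → Pred Baire 0ℓ} →
          (∀ n → NowhereDense (D n)) → (∀ n → NowhereDense (E n)) →
          ∃[ x ] ∀ n → ¬ (x ∈ D n) × ¬ (x ∈ E n)
  baire {D} {E} D-nd E-nd = limit , λ n →
    let _ , _ , _ , _ , D-avoided , E-avoided = step n
    in D-avoided limit (limit≈ (suc n)) , E-avoided limit (limit≈ (suc n))
    where
    depth : ℕ → ℕ
    approx : ℕ → Baire
    step : ∀ n → ∃[ n′ ] ∃[ x′ ] depth n < n′ × x′ ≈[ depth n ] approx n ×
                 Avoids (D n) n′ x′ × Avoids (E n) n′ x′
    depth zero = 0
    depth (suc n) = proj₁ (step n)
    approx zero = λ _ → 0
    approx (suc n) = proj₁ (proj₂ (step n))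
    step n = avoid₂ (D-nd n) (E-nd n) (depth n) (approx n)

    depth-< : ∀ n → depth n < depth (suc n)
    depth-< n = proj₁ (proj₂ (proj₂ (step n)))

    n≤depth : ∀ n → n ≤ depth n
    n≤depth zero    = z≤n
    n≤depth (suc n) = ≤-<-trans (n≤depth n) (depth-< n)

    approx≈ : ∀ m k → approx (k + m) ≈[ depth m ] approx m × depth m ≤ depth (k + m)
    approx≈ m zero = (λ _ _ → refl) , ≤-refl
    approx≈ m (suc k) =
      let ≈m , m≤ = approx≈ m k
      in ≈-trans (≈-weaken m≤ (proj₁ (proj₂ (proj₂ (proj₂ (step (k + m))))))) ≈m ,
         ≤-trans m≤ (<⇒≤ (depth-< (k + m)))

    -- Coordinate `i` is settled by stage `suc i`, whose depth exceeds `i`.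
    limit : Baire
    limit i = approx (suc i) i

    limit≈ : ∀ m → limit ≈[ depth m ] approx m
    limit≈ m i i<depth = begin
      approx (suc i) i        ≡⟨ proj₁ (approx≈ (suc i) m) i (n≤depth (suc i)) ⟨
      approx (m + suc i) i    ≡⟨ cong (λ k → approx k i) (+-comm m (suc i)) ⟩
      approx (suc i + m) i    ≡⟨ proj₁ (approx≈ m (suc i)) i i<depth ⟩
      approx m i              ∎
      where open ≡-Reasoning

  ℳ-proper : IsProperIdeal ℳ
  ℳ-proper = record
    { ⊆-closed = λ { A⊆B (D , nd , B⊆) → D , nd , B⊆ ∘ A⊆B }
    ; ∅-member = (λ _ → ∅) , (λ _ → ∅-nowhereDense) , λ ()
    ; proper   = λ { (D , D-nd , A⊆) (E , E-nd , B⊆) →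
        let x , avoided = baire D-nd E-nd
        in x , (λ x∈A → let n , x∈D = A⊆ x∈A in proj₁ (avoided n) x∈D)
             , (λ x∈B → let n , x∈E = B⊆ x∈B in proj₂ (avoided n) x∈E) }
    }

  𝒦-proper : IsProperIdeal 𝒦
  𝒦-proper = record
    { ⊆-closed = λ { A⊆B (C , σ , B⊆C) → C , σ , B⊆C ∘ A⊆B }
    ; ∅-member = ∅ , ((λ _ → ∅) , (λ _ → ∅-compact) , (λ ()) , proj₂) , id
    ; proper   = λ A∈𝒦 B∈𝒦 → IsProperIdeal.proper ℳ-proper (𝒦⊆ℳ A∈𝒦) (𝒦⊆ℳ B∈𝒦)
    }

-- Pointwise relations and the inequalities they induce.

module Inequalities (em : ∀ {ℓ} → ExcludedMiddle ℓ)
                    (ext : ∀ {a b} → Extensionality a b) where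
  open import Data.Nat.Base using (_+_; _⊔_; _≤_; _<_)
  open import Data.Nat.Properties
  open Classical em ext

  ∀*-contradiction : {P Q : Pred ℕ 0ℓ} → ∀* P → ∀* Q →
                     ¬ (∀ {n} → P n → ¬ Q n)
  ∀*-contradiction (m , p) (m′ , q) h =
    h (p (m ⊔ m′) (m≤m⊔n m m′)) (q (m ⊔ m′) (m≤n⊔m m m′))

  always : {P : Pred ℕ 0ℓ} → (∀ n → P n) → ∀* P
  always p = 0 , λ n _ → p n

  ∀*-map : {P Q : Pred ℕ 0ℓ} → (∀ {n} → P n → Q n) → ∀* P → ∀* Q
  ∀*-map f = map₂ λ p n m≤n → f (p n m≤n)

  maxElement : FinSet → ℕ
  maxElement a = max 0 (FinSet.elements a)

  ∈⇒≤maxElement : ∀ {k} a → k ∈ᶠ a → k ≤ maxElement a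
  ∈⇒≤maxElement a = All.lookup (xs≤max 0 (FinSet.elements a))

  upper : Slalom → Baire
  upper s n = maxElement (Slalom.at s n)

  ∈*⇒≤* : ∀ x s → x ⟨ ∈* ⟩ s → x ⟨ ≤* ⟩ upper s
  ∈*⇒≤* x s = ∀*-map λ {n} → ∈⇒≤maxElement (Slalom.at s n)

  ≤*⇒≠*suc : ∀ x y → x ⟨ ≤* ⟩ y → x ⟨ ≠* ⟩ (suc ∘ y)
  ≤*⇒≠*suc x y = ∀*-map λ x≤y → <⇒≢ (s≤s x≤y)

  singletons : Baire → Slalom
  singletons x = slalom at width
    where
    at : ℕ → FinSet
    -- Width 0 forces the empty set here, so membership holds only from 1 on.
    at zero    = finSet [] []
    at (suc n) = finSet (x (suc n) ∷ []) [-]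
    width : ∀ n → ∣ at n ∣ᶠ ≤ n
    width zero    = z≤n
    width (suc n) = s≤s z≤n

  -- Together with `escape`, this makes the family of all functions dominating and unbounded, so
  -- that the cardinals exist.
  above : ∀ R → Baire → Bound R
  above ≤* x = x
  above ≠* x = suc ∘ x
  above ∈* x = singletons x

  ⟨⟩-above : ∀ R x → x ⟨ R ⟩ above R x
  ⟨⟩-above ≤* x = always λ n → ≤-refl
  ⟨⟩-above ≠* x = always λ n → <⇒≢ ≤-refl
  ⟨⟩-above ∈* x = 1 , λ { (suc n) _ → here refl }

  escape : ∀ R → Bound R → Baire
  escape ≤* y = suc ∘ y
  escape ≠* y = y
  escape ∈* s = suc ∘ upper s

  escape-¬⟨⟩ : ∀ R y → ¬ (escape R y ⟨ R ⟩ y)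
  escape-¬⟨⟩ ≤* y (m , y<y) = 1+n≰n (y<y m ≤-refl)
  escape-¬⟨⟩ ≠* y (m , y≢y) = y≢y m ≤-refl refl
  escape-¬⟨⟩ ∈* s r = escape-¬⟨⟩ ≤* (upper s) (∈*⇒≤* _ s r)

  -- Cantor's enumeration of the pairs along the diagonals.
  nextPair : ℕ × ℕ → ℕ × ℕ
  nextPair (zero  , j) = suc j , zero
  nextPair (suc n , j) = n , suc j

  unpair : ℕ → ℕ × ℕ
  unpair zero    = zero , zero
  unpair (suc m) = nextPair (unpair m)

  -- Walks the enumeration backwards: down the diagonal while the second component is positive, then
  -- to the end of the previous diagonal.
  unpair-surjective : ∀ n j → ∃[ m ] unpair m ≡ (n , j)
  unpair-surjective n j = go (n + j) n j refl
    where
    go : ∀ s n j → n + j ≡ s → ∃[ m ] unpair m ≡ (n , j)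
    go zero    zero    zero    _    = 0 , refl
    go (suc s) (suc n) zero    eq with go s zero n (trans (sym (+-identityʳ n)) (suc-injective eq))
    ... | m , eq′ = suc m , cong nextPair eq′
    go s       n       (suc j) eq with go s (suc n) j (trans (sym (+-suc n j)) eq)
    ... | m , eq′ = suc m , cong nextPair eq′

  pair : ℕ → ℕ → ℕ
  pair n j = proj₁ (unpair-surjective n j)

  unpair-pair : ∀ n j → unpair (pair n j) ≡ (n , j)
  unpair-pair n j = proj₂ (unpair-surjective n j)

  unpair-≤ : ∀ m → proj₁ (unpair m) + proj₂ (unpair m) ≤ m
  unpair-≤ zero = z≤n
  unpair-≤ (suc m) with unpair m | unpair-≤ m
  ... | zero  , j | le = s≤s (≤-trans (≤-reflexive (+-identityʳ j)) le)
  ... | suc n , j | le = ≤-trans (≤-reflexive (+-suc n j)) (m≤n⇒m≤1+n le)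

  -- Ensures that an agreement found in a late row sits at a late position.
  n≤pair : ∀ n j → n ≤ pair n j
  n≤pair n j = begin
    n                                                         ≤⟨ m≤m+n n j ⟩
    n + j                                                     ≡⟨ cong (λ (n , j) → n + j) (unpair-pair n j) ⟨
    proj₁ (unpair (pair n j)) + proj₂ (unpair (pair n j))     ≤⟨ unpair-≤ (pair n j) ⟩
    pair n j                                                  ∎
    where open ≤-Reasoning

  code : ℕ → Baire → ℕ
  code zero    x = 0
  code (suc n) x = pair (x 0) (code n (x ∘ suc))

  entry : ℕ → ℕ → ℕ
  entry zero    c = proj₁ (unpair c)
  entry (suc j) c = entry j (proj₂ (unpair c))

  entry-code : ∀ {n j} x → j < n → entry j (code n x) ≡ x j
  entry-code {suc n} {zero} x _ = cong proj₁ (unpair-pair (x 0) (code n (x ∘ suc)))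
  entry-code {suc n} {suc j} x (s≤s j<n) =
    trans (cong (entry j ∘ proj₂) (unpair-pair (x 0) (code n (x ∘ suc))))
      (entry-code (x ∘ suc) j<n)

  -- Indices beyond the end of the list give 0.
  nth : List ℕ → ℕ → ℕ
  nth []       _       = 0
  nth (k ∷ ks) zero    = k
  nth (k ∷ ks) (suc j) = nth ks j

  ∈⇒nth : ∀ {k ks} → k ∈ˡ ks → ∃[ j ] j < length ks × nth ks j ≡ k
  ∈⇒nth (here refl) = 0 , s≤s z≤n , refl
  ∈⇒nth (there k∈)  with ∈⇒nth k∈
  ... | j , j< , eq = suc j , s≤s j< , eq

  -- The n-th row of x is the sequence j ↦ x (pair n j).
  rows : Baire → Baire
  rows x n = code n (x ∘ pair n)

  -- The j-th element of s n is read as a guess for row n and is used for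
  -- its j-th entry only, so that one correct guess for row n yields a point
  -- of agreement in that row.
  guess : Slalom → Baire
  guess s m =
    let n , j = unpair m
    in entry j (nth (FinSet.elements (Slalom.at s n)) j)

  guess-pair : ∀ s n j →
               guess s (pair n j) ≡ entry j (nth (FinSet.elements (Slalom.at s n)) j)
  guess-pair s n j =
    cong (λ (n , j) → entry j (nth (FinSet.elements (Slalom.at s n)) j)) (unpair-pair n j)

  -- The irrelevant width proof is recovered because the order on naturals is decidable.
  size-at : ∀ s n → ∣ Slalom.at s n ∣ᶠ ≤ n
  size-at (slalom at width) n = recompute (_ ≤? n) (width n)

  -- Beyond both thresholds the code of row `n` is the `j`-th element of the slalom for some `j`.
  -- The width bound gives `j < n`, so entry `j` of that code is a true value of `x`.
  guess-agrees : ∀ x s → rows x ⟨ ∈* ⟩ s → ¬ (guess s ⟨ ≠* ⟩ x)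
  guess-agrees x s (m , rows∈) (m′ , guess≢)
    with ∈⇒nth (rows∈ (m ⊔ m′) (m≤m⊔n m m′))
  ... | j , j< , nth≡ = guess≢ (pair n j) (≤-trans (m≤n⊔m m m′) (n≤pair n j)) (begin
    guess s (pair n j)                                   ≡⟨ guess-pair s n j ⟩
    entry j (nth (FinSet.elements (Slalom.at s n)) j)    ≡⟨ cong (entry j) nth≡ ⟩
    entry j (rows x n)                                   ≡⟨ entry-code (x ∘ pair n) (<-≤-trans j< (size-at s n)) ⟩
    x (pair n j)                                         ∎)
    where
    open ≡-Reasoning
    n = m ⊔ m′

  dominating : ∀ R {𝓘 : Ideal ℓ} → IsProperIdeal 𝓘 → ∃ (Dominating R 𝓘)
  dominating R p = (λ _ → ⊤) , λ g → above R ∘ g , tt ,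
    ⊆-closed (λ {x} ¬r → ¬r (⟨⟩-above R (g x))) ∅-member
    where open IsProperIdeal p

  unbounded : ∀ R {𝓘 : Ideal ℓ} → IsProperIdeal 𝓘 → ∃ (Unbounded R 𝓘)
  unbounded R p = (λ _ → ⊤) , λ (g , bounds) →
    let small       = bounds (escape R ∘ g) tt
        -- Properness for the same small set twice gives a point outside it.
        x , ¬¬r , _ = proper small small
    in ¬¬r (escape-¬⟨⟩ R (g x))
    where open IsProperIdeal p

  -- Covers both a change of relation over one ideal and a change of ideal with `ψ = id`. For 𝔟 the
  -- family stays and `ψ` acts on its bounds; for 𝔡 it acts on the family.
  module _ R R′ {𝓘 : Ideal ℓ} {𝓙 : Ideal ℓ′}
           (𝓘-proper : IsProperIdeal 𝓘) (𝓙-proper : IsProperIdeal 𝓙)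
           (ψ : Bound R → Bound R′)
           (weaken : ∀ {f g} → f ⟨ R / 𝓘 ⟩ g → f ⟨ R′ / 𝓙 ⟩ (ψ ∘ g)) where

    𝔟-mono : 𝔟 R 𝓘 ≼ 𝔟 R′ 𝓙
    𝔟-mono = ≼-image {P = Unbounded R 𝓘} {Q = Unbounded R′ 𝓙} id
      (λ unbdd (g , bounds) → unbdd (ψ ∘ g , λ f f∈A → weaken (bounds f (f , f∈A , refl))))
      (unbounded R′ 𝓙-proper)

    𝔡-antimono : 𝔡 R′ 𝓙 ≼ 𝔡 R 𝓘
    𝔡-antimono = ≼-image {P = Dominating R′ 𝓙} {Q = Dominating R 𝓘} (ψ ∘_)
      (λ dom g → let f , f∈A , r = dom g in ψ ∘ f , (f , f∈A , refl) , weaken r)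
      (dominating R 𝓘-proper)

  -- The image under φ of a dominating family is unbounded: a bound g of it
  -- and a member f dominating ψ ∘ g would clash outside two small sets.
  𝔟≼𝔡 : ∀ R R′ {𝓘 : Ideal ℓ} → IsProperIdeal 𝓘 →
         (φ : Bound R′ → Baire) (ψ : Bound R → Baire) →
         (∀ y z → φ z ⟨ R ⟩ y → ¬ (ψ y ⟨ R′ ⟩ z)) → 𝔟 R 𝓘 ≼ 𝔡 R′ 𝓘
  𝔟≼𝔡 R R′ {𝓘} p φ ψ clash =
    ≼-image {P = Unbounded R 𝓘} {Q = Dominating R′ 𝓘} (φ ∘_)
      (λ dom (g , bounds) →
        let f , f∈A , small = dom (ψ ∘ g)
            x , ¬¬r , ¬¬r′  = proper (bounds (φ ∘ f) (f , f∈A , refl)) small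
        in ¬¬r λ r → ¬¬r′ λ r′ → clash (g x) (f x) r r′)
      (dominating R′ p)
    where open IsProperIdeal p

  module _ {𝓘 : Ideal ℓ} (p : IsProperIdeal 𝓘) where
    open IsProperIdeal p

    pointwise : ∀ R R′ (ψ : Bound R → Bound R′) →
                (∀ x y → x ⟨ R ⟩ y → x ⟨ R′ ⟩ ψ y) →
                𝔟 R 𝓘 ≼ 𝔟 R′ 𝓘 × 𝔡 R′ 𝓘 ≼ 𝔡 R 𝓘
    pointwise R R′ ψ imp = 𝔟-mono R R′ p p ψ weaken , 𝔡-antimono R R′ p p ψ weaken
      where
      weaken : ∀ {f g} → f ⟨ R / 𝓘 ⟩ g → f ⟨ R′ / 𝓘 ⟩ (ψ ∘ g)
      weaken = ⊆-closed λ ¬r′ r → ¬r′ (imp _ _ r)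

    chains : ( 𝔟 ∈* 𝓘 ≼ 𝔟 ≤* 𝓘 × 𝔟 ≤* 𝓘 ≼ 𝔟 ≠* 𝓘 ) ×
             ( 𝔡 ≠* 𝓘 ≼ 𝔡 ≤* 𝓘 × 𝔡 ≤* 𝓘 ≼ 𝔡 ∈* 𝓘 )
    chains =
      let b₁ , d₁ = pointwise ∈* ≤* upper ∈*⇒≤*
          b₂ , d₂ = pointwise ≤* ≠* (suc ∘_) ≤*⇒≠*suc
      in (b₁ , b₂) , (d₂ , d₁)

    diagram : ( 𝔟 ∈* 𝓘 ≼ 𝔟 ≤* 𝓘 × 𝔟 ≤* 𝓘 ≼ 𝔟 ≠* 𝓘 × 𝔟 ≠* 𝓘 ≼ 𝔡 ∈* 𝓘 ) ×
              ( 𝔟 ∈* 𝓘 ≼ 𝔡 ≠* 𝓘 × 𝔡 ≠* 𝓘 ≼ 𝔡 ≤* 𝓘 × 𝔡 ≤* 𝓘 ≼ 𝔡 ∈* 𝓘 ) ×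
              𝔟 ≤* 𝓘 ≼ 𝔡 ≤* 𝓘
    diagram =
      let (b₁ , b₂) , d = chains
      in ( b₁ , b₂
         -- `guess-agrees` serves this inequality and the next, with the roles of `guess` and `rows`
         -- exchanged.
         , 𝔟≼𝔡 ≠* ∈* p guess rows λ y s s≠y y∈s → guess-agrees y s y∈s s≠y )
       , ( 𝔟≼𝔡 ∈* ≠* p rows guess (λ s y → guess-agrees y s) , d )
       , 𝔟≼𝔡 ≤* ≤* p id (suc ∘_) λ y z z≤y y<z → ∀*-contradiction y<z z≤y <⇒≱

theorem1p1 :
  (∀ {ℓ} → ExcludedMiddle ℓ) →
  (∀ {a b} → Extensionality a b) →
  -- null ideal
  ( ( 𝔟 ∈* 𝒩 ≼ 𝔟 ≤* 𝒩 × 𝔟 ≤* 𝒩 ≼ 𝔟 ≠* 𝒩 × 𝔟 ≠* 𝒩 ≼ 𝔡 ∈* 𝒩 ) ×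
    ( 𝔟 ∈* 𝒩 ≼ 𝔡 ≠* 𝒩 × 𝔡 ≠* 𝒩 ≼ 𝔡 ≤* 𝒩 × 𝔡 ≤* 𝒩 ≼ 𝔡 ∈* 𝒩 ) ×
    𝔟 ≤* 𝒩 ≼ 𝔡 ≤* 𝒩 ) ×
  -- meager ideal
  ( ( 𝔟 ∈* ℳ ≼ 𝔟 ≤* ℳ × 𝔟 ≤* ℳ ≼ 𝔟 ≠* ℳ × 𝔟 ≠* ℳ ≼ 𝔡 ∈* ℳ ) ×
    ( 𝔟 ∈* ℳ ≼ 𝔡 ≠* ℳ × 𝔡 ≠* ℳ ≼ 𝔡 ≤* ℳ × 𝔡 ≤* ℳ ≼ 𝔡 ∈* ℳ ) ×
    𝔟 ≤* ℳ ≼ 𝔡 ≤* ℳ ) ×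
  -- σ-compact ideal
  ( ( 𝔟 ∈* 𝒦 ≼ 𝔟 ≤* 𝒦 × 𝔟 ≤* 𝒦 ≼ 𝔟 ≠* 𝒦 ) ×
    ( 𝔡 ≠* 𝒦 ≼ 𝔡 ≤* 𝒦 × 𝔡 ≤* 𝒦 ≼ 𝔡 ∈* 𝒦 ) ) ×
  -- comparison
  ( ∀ R → 𝔟 R 𝒦 ≼ 𝔟 R ℳ × 𝔡 R ℳ ≼ 𝔡 R 𝒦 )
theorem1p1 em ext =
  diagram 𝒩-proper , diagram ℳ-proper , chains 𝒦-proper , λ R →
    𝔟-mono R R 𝒦-proper ℳ-proper id 𝒦⊆ℳ ,
    𝔡-antimono R R 𝒦-proper ℳ-proper id 𝒦⊆ℳ
  where
  open Nullity em ext using (𝒩-proper)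
  open Category em ext using (ℳ-proper; 𝒦-proper; 𝒦⊆ℳ)
  open Inequalities em ext
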